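{- Let $ALG$ be any deterministic semi-online algorithm with $1$-lookahead for makespan minimization on $3$ identical parallel machines (the problem $P_3\,|\,LA_1\,|\,C_{max}$). Then there exists an instance $\sigma$ such that $\frac{C_{ALG}(\sigma)}{C_{OPT}(\sigma)}\ge \frac{15}{11}$.
   Context: An instance $\sigma=\langle J_1,\dots,J_n\rangle$ is a finite list of independent jobs, where job $J_i$ has a real processing time $p_i>0$. The jobs must be assigned to $3$ identical machines $M_1,M_2,M_3$. The load $l_j$ of machine $M_j$ is the sum of the processing times of the jobs assigned to it, and the makespan of a schedule is $\max_j l_j$. $C_{OPT}(\sigma)$ is the minimum makespan over all assignments of the jobs to the machines (offline optimum), and $C_{ALG}(\sigma)$ is the makespan of the assignment produced by $ALG$ on $\sigma$. Semi-online model with $1$-lookahead ($LA_1$): the jobs are received one by one in the order $J_1,\dots,J_n$. Upon receiving $J_i$, the algorithm knows $p_1,\dots,p_i$ and, if $i<n$, also $p_{i+1}$, and has no further information about the later jobs. It must assign $J_i$ non-preemptively and irrevocably to a machine before the next job is received. Thus a deterministic algorithm's assignment of $J_i$ is a function of $i$ and the sequence $(p_1,\dots,p_{\min(i+1,n)})$. -}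

module Defs where

open import Data.Bool using (if_then_else_)
open import Data.Fin using (Fin; toℕ; _≟_)
open import Data.Fin.Patterns using (0F; 1F; 2F)
open import Data.Integer as ℤ using (+_)
open import Data.Integer.Tactic.RingSolver using (solve-∀)
open import Data.List as List using (List)
open import Data.Nat as ℕ using (ℕ; zero; suc)
open import Data.Product using (∃-syntax)
open import Data.Rational as ℚ using (ℚ; 0ℚ; _/_; toℚᵘ)
import Data.Rational.Properties as ℚ
open import Data.Rational.Solver using (module +-*-Solver)
import Data.Rational.Unnormalised as ℚᵘ
import Data.Rational.Unnormalised.Properties as ℚᵘ
open import Data.Vec as Vec using (Vec; []; _∷_)
open import Relation.Binary.PropositionalEquality
  using (_≡_; refl; cong; cong₂)
open import Relation.Nullary using (does)

-- Real numbers, as Bishop's regular sequences of rationals (indexed from 0).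

ε : ℕ → ℚ
ε n = + 1 / suc n

record ℝ : Set where
  constructor mkℝ
  field
    seq : ℕ → ℚ
    -- Quantifying over both orders of m and n makes this
    -- ∣ seq m - seq n ∣ ≤ ε m + ε n.
    reg : ∀ m n → seq m ℚ.≤ seq n ℚ.+ (ε m ℚ.+ ε n)

open ℝ public

infix  4 _≤_ _<_
infixl 6 _+_ _⊔_ _⊓_
infixr 7 _·_

private
  ε-nonNeg : ∀ n → 0ℚ ℚ.≤ ε n
  ε-nonNeg n = ℚ.nonNegative⁻¹ (ε n) {{ℚ.normalize-nonNeg 1 (suc n)}}

  double : ℕ → ℕ
  double n = suc (n ℕ.+ n)

  ε-double : ∀ n → ε (double n) ℚ.+ ε (double n) ≡ ε n
  ε-double n = ℚ.toℚᵘ-injective (begin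
    toℚᵘ (ε k ℚ.+ ε k)           ≈⟨ ℚ.toℚᵘ-homo-+ (ε k) (ε k) ⟩
    toℚᵘ (ε k) ℚᵘ.+ toℚᵘ (ε k)   ≈⟨ ℚᵘ.+-cong (ℚ.toℚᵘ-fromℚᵘ εᵘk) (ℚ.toℚᵘ-fromℚᵘ εᵘk) ⟩
    εᵘk ℚᵘ.+ εᵘk                 ≈⟨ ℚᵘ.*≡* (halves (+ n)) ⟩
    ℚᵘ.mkℚᵘ (+ 1) n              ≈⟨ ℚ.toℚᵘ-fromℚᵘ (ℚᵘ.mkℚᵘ (+ 1) n) ⟨
    toℚᵘ (ε n)                   ∎)
    where
    open ℚᵘ.≃-Reasoning
    k   = double n
    εᵘk = ℚᵘ.mkℚᵘ (+ 1) k
    halves : ∀ i → let d = + 2 ℤ.+ (i ℤ.+ i) in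
      (+ 1 ℤ.* d ℤ.+ + 1 ℤ.* d) ℤ.* (+ 1 ℤ.+ i) ≡ + 1 ℤ.* (d ℤ.* d)
    halves = solve-∀

  interchange : ∀ a b c d e f → (a ℚ.+ (c ℚ.+ d)) ℚ.+ (b ℚ.+ (e ℚ.+ f))
                              ≡ (a ℚ.+ b) ℚ.+ ((c ℚ.+ e) ℚ.+ (d ℚ.+ f))
  interchange = solve 6 (λ a b c d e f →
      (a :+ (c :+ d)) :+ (b :+ (e :+ f)) := (a :+ b) :+ ((c :+ e) :+ (d :+ f))) refl
    where open +-*-Solver

fromℚ : ℚ → ℝ
seq (fromℚ q) _   = q
reg (fromℚ q) m n = begin
  q                        ≡⟨ ℚ.+-identityʳ q ⟨
  q ℚ.+ 0ℚ                 ≤⟨ ℚ.+-monoʳ-≤ q (ℚ.+-mono-≤ (ε-nonNeg m) (ε-nonNeg n)) ⟩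
  q ℚ.+ (ε m ℚ.+ ε n)      ∎
  where open ℚ.≤-Reasoning

0ℝ : ℝ
0ℝ = fromℚ 0ℚ

_+_ : ℝ → ℝ → ℝ
seq (x + y) n   = seq x (double n) ℚ.+ seq y (double n)
reg (x + y) m n = begin
  seq x m′ ℚ.+ seq y m′
    ≤⟨ ℚ.+-mono-≤ (reg x m′ n′) (reg y m′ n′) ⟩
  (seq x n′ ℚ.+ (ε m′ ℚ.+ ε n′)) ℚ.+ (seq y n′ ℚ.+ (ε m′ ℚ.+ ε n′))
    ≡⟨ interchange (seq x n′) (seq y n′) (ε m′) (ε n′) (ε m′) (ε n′) ⟩
  (seq x n′ ℚ.+ seq y n′) ℚ.+ ((ε m′ ℚ.+ ε m′) ℚ.+ (ε n′ ℚ.+ ε n′))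
    ≡⟨ cong (seq x n′ ℚ.+ seq y n′ ℚ.+_) (cong₂ ℚ._+_ (ε-double m) (ε-double n)) ⟩
  (seq x n′ ℚ.+ seq y n′) ℚ.+ (ε m ℚ.+ ε n) ∎
  where
  open ℚ.≤-Reasoning
  m′ = double m
  n′ = double n

_⊔_ : ℝ → ℝ → ℝ
seq (x ⊔ y) n   = seq x n ℚ.⊔ seq y n
reg (x ⊔ y) m n = ℚ.⊔-lub
  (ℚ.≤-trans (reg x m n) (ℚ.+-monoˡ-≤ (ε m ℚ.+ ε n) (ℚ.p≤p⊔q (seq x n) (seq y n))))
  (ℚ.≤-trans (reg y m n) (ℚ.+-monoˡ-≤ (ε m ℚ.+ ε n) (ℚ.p≤q⊔p (seq x n) (seq y n))))

_⊓_ : ℝ → ℝ → ℝ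
seq (x ⊓ y) n   = seq x n ℚ.⊓ seq y n
reg (x ⊓ y) m n = begin
  seq x m ℚ.⊓ seq y m
    ≤⟨ ℚ.⊓-mono-≤ (reg x m n) (reg y m n) ⟩
  (seq x n ℚ.+ δ) ℚ.⊓ (seq y n ℚ.+ δ)
    ≡⟨ ℚ.mono-≤-distrib-⊓ (ℚ.+-monoˡ-≤ δ) (seq x n) (seq y n) ⟨
  (seq x n ℚ.⊓ seq y n) ℚ.+ δ ∎
  where
  open ℚ.≤-Reasoning
  δ = ε m ℚ.+ ε n

_·_ : ℕ → ℝ → ℝ
zero  · x = 0ℝ
suc k · x = x + k · x

_≤_ : ℝ → ℝ → Set
x ≤ y = ∀ n → seq x n ℚ.≤ seq y n ℚ.+ (ε n ℚ.+ ε n)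

_<_ : ℝ → ℝ → Set
x < y = ∃[ n ] seq x n ℚ.+ (ε n ℚ.+ ε n) ℚ.< seq y n

-- Scheduling on three identical machines.

Machine : Set
Machine = Fin 3

record Job : Set where
  field
    time   : ℝ
    0<time : 0ℝ < time

open Job public

Instance : ℕ → Set
Instance n = Vec Job n

Schedule : ℕ → Set
Schedule n = Vec Machine n

load : ∀ {n} → Instance n → Schedule n → Machine → ℝ
load []      []      j = 0ℝ
load (J ∷ σ) (i ∷ s) j = if does (i ≟ j) then time J + load σ s j else load σ s j

makespan : ∀ {n} → Instance n → Schedule n → ℝ
makespan σ s = load σ s 0F ⊔ load σ s 1F ⊔ load σ s 2F

minOverSchedules : ∀ n → (Schedule n → ℝ) → ℝ
minOverSchedules zero    f = f []
minOverSchedules (suc n) f = branch 0F ⊓ branch 1F ⊓ branch 2F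
  where
  branch : Machine → ℝ
  branch i = minOverSchedules n (λ s → f (i ∷ s))

-- Positive whenever there is at least one job, so for nonempty instances
-- C-ALG / C-OPT ≥ a / b amounts to a · C-OPT ≤ b · C-ALG; for the empty
-- instance the ratio is undefined.
C-OPT : ∀ {n} → Instance n → ℝ
C-OPT {n} σ = minOverSchedules n (makespan σ)

-- The machine for the i-th job (i counted from 1) as a function of i and the
-- jobs revealed so far.  An algorithm need not respect equality of reals: it
-- may inspect the representing sequences, so in particular every function of
-- the real processing times is included.

Algorithm : Set
Algorithm = ℕ → List Job → Machine

-- List.take truncates, so the i-th decision sees jobs 1, …, min (i + 1) n.

run : Algorithm → ∀ {n} → Instance n → Schedule n
run alg σ = Vec.tabulate λ k → let i = suc (toℕ k) in
  alg i (List.take (suc i) (Vec.toList σ))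

C-ALG : Algorithm → ∀ {n} → Instance n → ℝ
C-ALG alg σ = makespan σ (run alg σ)

{-# OPTIONS --safe #-}

-- The adversary starts with 2, 3, 5.  If the algorithm separates 2 and 3, it
-- sends a final 5: the optimum is 5, but the algorithm ends with at least
-- 7.  If 2 and 3 share a machine, it sends 7.  Should the 5 join them,
-- it stops: the optimum is 7, the algorithm is at 10 or more.  Otherwise it
-- sends a final 6: the optimum is 8, reached by {2,6}, {3,5}, {7}, while the
-- algorithm is at 11 or more.  Each ratio, 7/5, 10/7 and 11/8, is at least
-- 15/11.
module Submission where

open import Defs
open import Data.Bool using (true; false; if_then_else_)
open import Data.Fin using (_≟_)
open import Data.Fin.Patterns using (0F; 1F; 2F)
open import Data.Fin.Properties using (all?)
open import Data.Integer as ℤ using (+_)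
import Data.Integer.Properties as ℤ
open import Data.List using (_∷_; [])
open import Data.Nat as ℕ using (ℕ; zero; suc)
open import Data.Nat.Coprimality using (1-coprimeTo) renaming (sym to coprime-sym)
import Data.Nat.Properties as ℕ
open import Data.Product using (∃-syntax; Σ-syntax; _,_)
open import Data.Rational as ℚ using (ℚ; mkℚ; 0ℚ; _/_)
import Data.Rational.Properties as ℚ
open import Data.Sum using (inj₁; inj₂)
open import Data.Vec using (Vec; []; _∷_; lookup)
open import Data.Vec.Relation.Binary.Pointwise.Inductive using (Pointwise; []; _∷_)
open import Relation.Binary.PropositionalEquality
  using (_≡_; _≢_; refl; sym; trans; cong; cong₂)
open import Relation.Nullary
  using (Dec; yes; no; does; ¬?; True; toWitness; from-yes; _→-dec_)

-- Given in lowest terms directly, so that numerator and denominator compute for a variable `k`,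
-- with no gcd in the way.
fromℕ : ℕ → ℚ
fromℕ k = mkℚ (+ k) 0 (coprime-sym (1-coprimeTo k))

fromℕ-homo-+ : ∀ a b → fromℕ (a ℕ.+ b) ≡ fromℕ a ℚ.+ fromℕ b
-- Rational addition ends in a normalisation `_/ 1`; the left side is first brought to that form,
-- leaving an equation of numerators.
fromℕ-homo-+ a b = trans (sym (ℚ.fromℚᵘ-toℚᵘ (fromℕ (a ℕ.+ b))))
  (cong (_/ 1) (sym (cong₂ ℤ._+_ (ℤ.*-identityʳ (+ a)) (ℤ.*-identityʳ (+ b)))))

fromℕ-mono-≤ : ∀ {a b} → a ℕ.≤ b → fromℕ a ℚ.≤ fromℕ b
fromℕ-mono-≤ a≤b = ℚ.*≤* (ℤ.*-monoʳ-≤-nonNeg (+ 1) (ℤ.+≤+ a≤b))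

fromℕ-homo-⊔ : ∀ a b → fromℕ (a ℕ.⊔ b) ≡ fromℕ a ℚ.⊔ fromℕ b
fromℕ-homo-⊔ a b with ℕ.≤-total a b
... | inj₁ a≤b = trans (cong fromℕ (ℕ.m≤n⇒m⊔n≡n a≤b)) (sym (ℚ.p≤q⇒p⊔q≡q (fromℕ-mono-≤ a≤b)))
... | inj₂ b≤a = trans (cong fromℕ (ℕ.m≥n⇒m⊔n≡m b≤a)) (sym (ℚ.p≥q⇒p⊔q≡p (fromℕ-mono-≤ b≤a)))

infix 4 _≗_ _≤ₛ_

-- Stricter than equality of reals: the sequence is constant. Reindexing in `_+_` is then harmless
-- and no error terms arise.
_≗_ : ℝ → ℕ → Set
x ≗ a = ∀ n → seq x n ≡ fromℕ a

+-≗ : ∀ {x y a b} → x ≗ a → y ≗ b → x + y ≗ a ℕ.+ b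
+-≗ {a = a} {b} x≗a y≗b n = trans (cong₂ ℚ._+_ (x≗a _) (y≗b _)) (sym (fromℕ-homo-+ a b))

⊔-≗ : ∀ {x y a b} → x ≗ a → y ≗ b → x ⊔ y ≗ a ℕ.⊔ b
⊔-≗ {a = a} {b} x≗a y≗b n = trans (cong₂ ℚ._⊔_ (x≗a n) (y≗b n)) (sym (fromℕ-homo-⊔ a b))

·-≗ : ∀ k {x a} → x ≗ a → k · x ≗ k ℕ.* a
·-≗ zero        x≗a n = refl
·-≗ (suc k) {x} x≗a = +-≗ {x} {k · x} x≗a (·-≗ k {x} x≗a)

_≤ₛ_ : ℝ → ℝ → Set
x ≤ₛ y = ∀ n → seq x n ℚ.≤ seq y n

≤ₛ⇒≤ : ∀ {x y} → x ≤ₛ y → x ≤ y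
≤ₛ⇒≤ {x} {y} x≤y n = begin
  seq x n                      ≤⟨ x≤y n ⟩
  seq y n                      ≡⟨ ℚ.+-identityʳ (seq y n) ⟨
  seq y n ℚ.+ 0ℚ               ≤⟨ ℚ.+-monoʳ-≤ (seq y n) (ℚ.+-mono-≤ 0≤ε 0≤ε) ⟩
  seq y n ℚ.+ (ε n ℚ.+ ε n)    ∎
  where
  open ℚ.≤-Reasoning
  0≤ε : 0ℚ ℚ.≤ ε n
  0≤ε = ℚ.nonNegative⁻¹ (ε n) {{ℚ.normalize-nonNeg 1 (suc n)}}

·-monoʳ-≤ₛ : ∀ k {x y} → x ≤ₛ y → k · x ≤ₛ k · y
·-monoʳ-≤ₛ zero            x≤y n = ℚ.≤-refl
·-monoʳ-≤ₛ (suc k) {x} {y} x≤y n = ℚ.+-mono-≤ (x≤y _) (·-monoʳ-≤ₛ k {x} {y} x≤y _)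

-- Each nested `⊓` lies below the branch that `s` selects. Hence one good schedule bounds the
-- optimum from above.
minOverSchedules-≤ₛ : ∀ {n} (f : Schedule n → ℝ) s → minOverSchedules n f ≤ₛ f s
minOverSchedules-≤ₛ {zero}  f []      k = ℚ.≤-refl
minOverSchedules-≤ₛ {suc n} f (i ∷ s) k =
  ℚ.≤-trans (branches i) (minOverSchedules-≤ₛ (λ t → f (i ∷ t)) s k)
  where
  m : Machine → ℚ
  m j = seq (minOverSchedules n (λ t → f (j ∷ t))) k
  branches : ∀ j → m 0F ℚ.⊓ m 1F ℚ.⊓ m 2F ℚ.≤ m j
  branches 0F = ℚ.≤-trans (ℚ.p⊓q≤p (m 0F ℚ.⊓ m 1F) (m 2F)) (ℚ.p⊓q≤p (m 0F) (m 1F))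
  branches 1F = ℚ.≤-trans (ℚ.p⊓q≤p (m 0F ℚ.⊓ m 1F) (m 2F)) (ℚ.p⊓q≤q (m 0F) (m 1F))
  branches 2F = ℚ.p⊓q≤q (m 0F ℚ.⊓ m 1F) (m 2F)

loadℕ : ∀ {n} → Vec ℕ n → Schedule n → Machine → ℕ
loadℕ []       []      j = 0
loadℕ (p ∷ ps) (i ∷ s) j = if does (i ≟ j) then p ℕ.+ loadℕ ps s j else loadℕ ps s j

makespanℕ : ∀ {n} → Vec ℕ n → Schedule n → ℕ
makespanℕ ps s = loadℕ ps s 0F ℕ.⊔ loadℕ ps s 1F ℕ.⊔ loadℕ ps s 2F

Times : ∀ {n} → Instance n → Vec ℕ n → Set
Times = Pointwise (λ J p → time J ≗ p)

load-≗ : ∀ {n} {σ : Instance n} {ps} → Times σ ps → ∀ s j → load σ s j ≗ loadℕ ps s j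
load-≗ []                     []      j n = refl
load-≗ {σ = J ∷ σ} (J≗p ∷ σ≗ps) (i ∷ s) j with does (i ≟ j)
... | true  = +-≗ {time J} {load σ s j} J≗p (load-≗ σ≗ps s j)
... | false = load-≗ σ≗ps s j

makespan-≗ : ∀ {n} {σ : Instance n} {ps} → Times σ ps →
  ∀ s → makespan σ s ≗ makespanℕ ps s
makespan-≗ {σ = σ} σ≗ps s =
  ⊔-≗ {load σ s 0F ⊔ load σ s 1F} {load σ s 2F}
    (⊔-≗ {load σ s 0F} {load σ s 1F} (load-≗ σ≗ps s 0F) (load-≗ σ≗ps s 1F))
    (load-≗ σ≗ps s 2F)

-- Reduces the ratio to a comparison of naturals; `t` is a witness schedule bounding the optimum.
C-OPT-C-ALG-≤ : ∀ {n} {σ : Instance n} {ps} → Times σ ps → ∀ k l t alg →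
  k ℕ.* makespanℕ ps t ℕ.≤ l ℕ.* makespanℕ ps (run alg σ) → k · C-OPT σ ≤ l · C-ALG alg σ
C-OPT-C-ALG-≤ {σ = σ} {ps} σ≗ps k l t alg kt≤ls =
  ≤ₛ⇒≤ {k · C-OPT σ} {l · C-ALG alg σ} λ n → begin
    seq (k · C-OPT σ) n
      ≤⟨ ·-monoʳ-≤ₛ k {C-OPT σ} {makespan σ t} (minOverSchedules-≤ₛ (makespan σ) t) n ⟩
    seq (k · makespan σ t) n
      ≡⟨ ·-≗ k {makespan σ t} (makespan-≗ σ≗ps t) n ⟩
    fromℕ (k ℕ.* makespanℕ ps t)
      ≤⟨ fromℕ-mono-≤ kt≤ls ⟩
    fromℕ (l ℕ.* makespanℕ ps (run alg σ))
      ≡⟨ ·-≗ l {C-ALG alg σ} (makespan-≗ σ≗ps (run alg σ)) n ⟨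
    seq (l · C-ALG alg σ) n ∎
  where open ℚ.≤-Reasoning

job : (p : ℕ) → {True (0ℚ ℚ.+ (ε 2 ℚ.+ ε 2) ℚ.<? fromℕ p)} → Job
-- At index 2 the required gap is 2/3, below every positive integer.
job p {w} = record { time = fromℚ (fromℕ p) ; 0<time = 2 , toWitness w }

J₂ J₃ J₅ J₆ J₇ : Job
J₂ = job 2
J₃ = job 3
J₅ = job 5
J₆ = job 6
J₇ = job 7

σ₁ σ₂ : Instance 4
σ₁ = J₂ ∷ J₃ ∷ J₅ ∷ J₅ ∷ []
σ₂ = J₂ ∷ J₃ ∷ J₅ ∷ J₇ ∷ []

σ₃ : Instance 5
σ₃ = J₂ ∷ J₃ ∷ J₅ ∷ J₇ ∷ J₆ ∷ []

ps₁ ps₂ : Vec ℕ 4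
ps₁ = 2 ∷ 3 ∷ 5 ∷ 5 ∷ []
ps₂ = 2 ∷ 3 ∷ 5 ∷ 7 ∷ []

ps₃ : Vec ℕ 5
ps₃ = 2 ∷ 3 ∷ 5 ∷ 7 ∷ 6 ∷ []

exact : ∀ {p w} → time (job p {w}) ≗ p
exact n = refl

σ₁-times : Times σ₁ ps₁
σ₁-times = exact {2} ∷ exact {3} ∷ exact {5} ∷ exact {5} ∷ []

σ₂-times : Times σ₂ ps₂
σ₂-times = exact {2} ∷ exact {3} ∷ exact {5} ∷ exact {7} ∷ []

σ₃-times : Times σ₃ ps₃
σ₃-times = exact {2} ∷ exact {3} ∷ exact {5} ∷ exact {7} ∷ exact {6} ∷ []

-- A 5 placed with the 2 or the 3 gives at least 7, and two 5s on the third machine give 10; 75 ≤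
-- 77. Evaluation checks all placements.
σ₁-bound : ∀ s → lookup s 0F ≢ lookup s 1F → 15 ℕ.* 5 ℕ.≤ 11 ℕ.* makespanℕ ps₁ s
σ₁-bound (a ∷ b ∷ c ∷ d ∷ []) = bound a b c d
  where
  bound : ∀ a b c d → a ≢ b → 15 ℕ.* 5 ℕ.≤ 11 ℕ.* makespanℕ ps₁ (a ∷ b ∷ c ∷ d ∷ [])
  bound = from-yes (all? λ a → all? λ b → all? λ c → all? λ d →
    ¬? (a ≟ b) →-dec (15 ℕ.* 5 ℕ.≤? 11 ℕ.* makespanℕ ps₁ (a ∷ b ∷ c ∷ d ∷ [])))

-- The shared machine already carries 2 + 3 + 5 = 10, and 105 ≤ 110.
σ₂-bound : ∀ s → lookup s 0F ≡ lookup s 1F → lookup s 0F ≡ lookup s 2F →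
  15 ℕ.* 7 ℕ.≤ 11 ℕ.* makespanℕ ps₂ s
σ₂-bound (a ∷ .a ∷ .a ∷ d ∷ []) refl refl = bound a d
  where
  bound : ∀ a d → 15 ℕ.* 7 ℕ.≤ 11 ℕ.* makespanℕ ps₂ (a ∷ a ∷ a ∷ d ∷ [])
  bound = from-yes (all? λ a → all? λ d →
    15 ℕ.* 7 ℕ.≤? 11 ℕ.* makespanℕ ps₂ (a ∷ a ∷ a ∷ d ∷ []))

-- Two machines carry 5 each before 7 and 6 arrive: joining either gives at least 5 + 6 = 11, and
-- avoiding both gives 13; 120 ≤ 121.
σ₃-bound : ∀ s → lookup s 0F ≡ lookup s 1F → lookup s 0F ≢ lookup s 2F →
  15 ℕ.* 8 ℕ.≤ 11 ℕ.* makespanℕ ps₃ s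
σ₃-bound (a ∷ .a ∷ c ∷ d ∷ e ∷ []) refl = bound a c d e
  where
  bound : ∀ a c d e → a ≢ c → 15 ℕ.* 8 ℕ.≤ 11 ℕ.* makespanℕ ps₃ (a ∷ a ∷ c ∷ d ∷ e ∷ [])
  bound = from-yes (all? λ a → all? λ c → all? λ d → all? λ e →
    ¬? (a ≟ c) →-dec (15 ℕ.* 8 ℕ.≤? 11 ℕ.* makespanℕ ps₃ (a ∷ a ∷ c ∷ d ∷ e ∷ [])))

theorem4 : (alg : Algorithm) →
    ∃[ n ] Σ[ σ ∈ Instance (suc n) ] 15 · C-OPT σ ≤ 11 · C-ALG alg σ
theorem4 alg = respond (a ≟ b) (a ≟ c)
  where
  -- With one job of lookahead, `a` and `b` are fixed before the fourth job is seen, so they hold on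
  -- all three instances. The choice `c` sees the 7 and is common to `σ₂` and `σ₃`.
  a b c : Machine
  a = alg 1 (J₂ ∷ J₃ ∷ [])
  b = alg 2 (J₂ ∷ J₃ ∷ J₅ ∷ [])
  c = alg 3 (J₂ ∷ J₃ ∷ J₅ ∷ J₇ ∷ [])

  respond : Dec (a ≡ b) → Dec (a ≡ c) →
    ∃[ n ] Σ[ σ ∈ Instance (suc n) ] 15 · C-OPT σ ≤ 11 · C-ALG alg σ
  respond (no a≢b)  _         = 3 , σ₁ ,
    C-OPT-C-ALG-≤ {σ = σ₁} σ₁-times 15 11
      -- Jobs 2 and 3 share a machine and the others stand alone: makespan 5 here, and 7 when the
      -- last job is 7.
      (0F ∷ 0F ∷ 1F ∷ 2F ∷ []) alg (σ₁-bound (run alg σ₁) a≢b)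
  respond (yes a≡b) (yes a≡c) = 3 , σ₂ ,
    C-OPT-C-ALG-≤ {σ = σ₂} σ₂-times 15 11
      (0F ∷ 0F ∷ 1F ∷ 2F ∷ []) alg (σ₂-bound (run alg σ₂) a≡b a≡c)
  respond (yes a≡b) (no a≢c)  = 4 , σ₃ ,
    C-OPT-C-ALG-≤ {σ = σ₃} σ₃-times 15 11
      (0F ∷ 1F ∷ 1F ∷ 2F ∷ 0F ∷ []) alg (σ₃-bound (run alg σ₃) a≡b a≢c)
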